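{- For all LTL formulae $\varphi$: (1) $\mathrm{Pr}([\![\varphi]\!]_3(\mathrm{T})) = [\![\varphi]\!](\mathrm{T})$; (2) $\mathrm{Pr}([\![\varphi]\!]_3(\mathrm{F})) = [\![\varphi]\!](\mathrm{F})$.
   Context: Traces. Fix a set $A$ of atomic propositions and let $\Sigma = \mathcal{P}(A)$ be the set of states. $\Sigma^*$ is the set of finite traces (including the empty trace $\varepsilon$), $\Sigma^\omega$ the set of infinite traces, $\Sigma^\infty = \Sigma^* \cup \Sigma^\omega$. Concatenation is written $tu$, with $tu = t$ if $t$ is infinite. $t_0$ is the first state of a nonempty trace $t$; $t|_n$ is $t$ without its first $n$ states ($\varepsilon$ if $n$ exceeds the length of $t$). Definitive sets. For $X \subseteq \Sigma^\infty$, $\downarrow X = \{u \mid \exists t \in X.\ \exists v \in \Sigma^\infty.\ t = uv\}$; $\uparrow t = \{tu \mid u \in \Sigma^\infty\}$; $\mathrm{dp}(X) = \{t \in \Sigma^\infty\mid \uparrow t \subseteq \downarrow X\}$. $X$ is definitive iff $X = \mathrm{dp}(X)$. Definitive union: $X \sqcup Y = \mathrm{dp}(X \cup Y)$ and $\bigsqcup S = \mathrm{dp}(\bigcup S)$. Prepend: $\triangleright X = \{t \in \Sigma^\infty \mid t|_1 \in X\}$. For a definitive set $X$, $\mathrm{Pr}(X) = X \cap \Sigma^\omega$. LTL formulae: $\varphi,\psi ::= \top \mid a \mid \neg\varphi \mid \varphi\wedge\psi \mid \bigcirc\varphi \mid \varphi\,\mathcal{U}\,\psi$ with $a \in A$;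 $\varphi\vee\psi$ abbreviates $\neg(\neg\varphi\wedge\neg\psi)$. Conventional LTL semantics $[\![\varphi]\!] : \{\mathrm{T},\mathrm{F}\} \to \mathcal{P}(\Sigma^\omega)$, by recursion: $[\![\top]\!](\mathrm{T}) = \Sigma^\omega$, $[\![\top]\!](\mathrm{F}) = \emptyset$; $[\![a]\!](\mathrm{T}) = \{t\in\Sigma^\omega \mid a \in t_0\}$, $[\![a]\!](\mathrm{F}) = \{t\in\Sigma^\omega \mid a \notin t_0\}$; $[\![\neg\varphi]\!](\mathrm{T}) = [\![\varphi]\!](\mathrm{F})$, $[\![\neg\varphi]\!](\mathrm{F}) = [\![\varphi]\!](\mathrm{T})$; $[\![\varphi\wedge\psi]\!](\mathrm{T}) = [\![\varphi]\!](\mathrm{T})\cap[\![\psi]\!](\mathrm{T})$, $[\![\varphi\wedge\psi]\!](\mathrm{F}) = [\![\varphi]\!](\mathrm{F})\cup[\![\psi]\!](\mathrm{F})$; $[\![\bigcirc\varphi]\!](b) = \{t \mid t|_1 \in [\![\varphi]\!](b)\}$ for $b\in\{\mathrm{T},\mathrm{F}\}$; $[\![\varphi\,\mathcal{U}\,\psi]\!](\mathrm{T}) = \{t \mid \exists k.\ (\forall i<k.\ t|_i \in [\![\varphi]\!](\mathrm{T})) \wedge t|_k \in [\![\psi]\!](\mathrm{T})\}$, $[\![\varphi\,\mathcal{U}\,\psi]\!](\mathrm{F}) = \{t \mid \forall k.\ (\exists i<k.\ t|_i \in [\![\varphi]\!](\mathrm{F})) \vee t|_k \in [\![\psi]\!](\mathrm{F})\}$.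 LTL$_3$ semantics $[\![\varphi]\!]_3$ assigns to each answer in $\{\mathrm{T},\mathrm{F}\}$ a definitive set, by recursion: $[\![\top]\!]_3(\mathrm{T}) = \Sigma^\infty$, $[\![\top]\!]_3(\mathrm{F}) = \emptyset$; $[\![a]\!]_3(\mathrm{T}) = \mathrm{dp}\{t\in\Sigma^\infty \mid t\ne\varepsilon \wedge a \in t_0\}$, $[\![a]\!]_3(\mathrm{F}) = \mathrm{dp}\{t\in\Sigma^\infty \mid t\neq\varepsilon \wedge a \notin t_0\}$; $[\![\neg\varphi]\!]_3(\mathrm{T}) = [\![\varphi]\!]_3(\mathrm{F})$, $[\![\neg\varphi]\!]_3(\mathrm{F}) = [\![\varphi]\!]_3(\mathrm{T})$; $[\![\varphi\wedge\psi]\!]_3(\mathrm{T}) = [\![\varphi]\!]_3(\mathrm{T})\cap[\![\psi]\!]_3(\mathrm{T})$, $[\![\varphi\wedge\psi]\!]_3(\mathrm{F}) = [\![\varphi]\!]_3(\mathrm{F})\sqcup[\![\psi]\!]_3(\mathrm{F})$; $[\![\bigcirc\varphi]\!]_3(b) = \triangleright([\![\varphi]\!]_3(b))$ for $b\in\{\mathrm{T},\mathrm{F}\}$; $[\![\varphi\,\mathcal{U}\,\psi]\!]_3(\mathrm{T}) = \bigsqcup_{k\in\mathbb{N}} f^k([\![\psi]\!]_3(\mathrm{T}))$ where $f(X) = \triangleright X \cap [\![\varphi]\!]_3(\mathrm{T})$; $[\![\varphi\,\mathcal{U}\,\psi]\!]_3(\mathrm{F}) = \bigcap_{k\in\mathbb{N}}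 g^k([\![\psi]\!]_3(\mathrm{F}))$ where $g(X) = \triangleright X \sqcup [\![\varphi]\!]_3(\mathrm{F})$. Here $f^k$ is the $k$-fold self-composition of $f$ ($f^0$ the identity). -}

module Defs where

open import Level using (Level; _⊔_) renaming (suc to lsuc)
open import Data.Empty using (⊥-elim)
open import Data.List.Base using (List; []; _∷_; _++_; drop)
open import Data.List.Relation.Binary.Pointwise.Base as List using ()
open import Data.Nat.Base using (ℕ; zero; suc; _+_; _<_)
open import Data.Product.Base using (∃; ∃-syntax; _×_)
open import Data.Sum.Base using (_⊎_; inj₁; inj₂)
open import Data.Sum.Relation.Binary.Pointwise as Sum using ()
open import Function.Endo.Propositional as Endo using ()
open import Relation.Binary.Core using (Rel)
open import Relation.Binary.PropositionalEquality.Core using (_≢_; refl)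
open import Relation.Unary using (Pred; _∈_; _∉_; _⊆_; _≐_; _∩_; _∪_; ⋃; ⋂; _⊢_)
open import Relation.Unary.Polymorphic using (U; ∅)

data Answer : Set where
  T F : Answer

infix  9 ¬_ ◯_
infixr 8 _𝒰_
infixr 7 _∧_

data LTL {a} (A : Set a) : Set a where
  ⊤    : LTL A
  atom : A → LTL A
  ¬_   : LTL A → LTL A
  _∧_  : LTL A → LTL A → LTL A
  ◯_   : LTL A → LTL A
  _𝒰_  : LTL A → LTL A → LTL A

module Semantics {a} (A : Set a) (ℓ : Level) where

  State : Set (a ⊔ lsuc ℓ)
  State = Pred A ℓ

  Σ* : Set (a ⊔ lsuc ℓ)
  Σ* = List State

  Σω : Set (a ⊔ lsuc ℓ)
  Σω = ℕ → State

  Σ∞ : Set (a ⊔ lsuc ℓ)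
  Σ∞ = Σ* ⊎ Σω

  -- Equality of traces is extensional: same length, and at each position
  -- the two states have the same members.
  infix 4 _≈_
  _≈_ : Rel Σ∞ (a ⊔ lsuc ℓ)
  _≈_ = Sum.Pointwise (List.Pointwise _≐_) (λ t u → ∀ n → t n ≐ u n)

  ε : Σ∞
  ε = inj₁ []

  infixr 5 _++ω_ _⋅_

  _++ω_ : Σ* → Σω → Σω
  ([]      ++ω v) n       = v n
  ((s ∷ u) ++ω v) zero    = s
  ((s ∷ u) ++ω v) (suc n) = (u ++ω v) n

  _⋅_ : Σ∞ → Σ∞ → Σ∞
  inj₁ t ⋅ inj₁ u = inj₁ (t ++ u)
  inj₁ t ⋅ inj₂ u = inj₂ (t ++ω u)
  inj₂ t ⋅ _      = inj₂ t

  first : (t : Σ∞) → t ≢ ε → State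
  first (inj₁ [])      t≢ε = ⊥-elim (t≢ε refl)
  first (inj₁ (s ∷ _)) _   = s
  first (inj₂ t)       _   = t 0

  infixl 6 _∣ω_ _∣_

  _∣ω_ : Σω → ℕ → Σω
  (t ∣ω n) i = t (n + i)

  _∣_ : Σ∞ → ℕ → Σ∞
  inj₁ t ∣ n = inj₁ (drop n t)
  inj₂ t ∣ n = inj₂ (t ∣ω n)

  TraceSet : Set (lsuc (a ⊔ lsuc ℓ))
  TraceSet = Pred Σ∞ (a ⊔ lsuc ℓ)

  ↓ : TraceSet → TraceSet
  ↓ X u = ∃[ t ] t ∈ X × (∃[ v ] t ≈ u ⋅ v)

  ↑ : Σ∞ → TraceSet
  ↑ t w = ∃[ u ] w ≈ t ⋅ u

  dp : TraceSet → TraceSet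
  dp X t = ↑ t ⊆ ↓ X

  infixr 6 _⊔ᵈ_
  _⊔ᵈ_ : TraceSet → TraceSet → TraceSet
  X ⊔ᵈ Y = dp (X ∪ Y)

  ⨆ : (I : Set) → (I → TraceSet) → TraceSet
  ⨆ I S = dp (⋃ I S)

  ▷ : TraceSet → TraceSet
  ▷ X t = t ∣ 1 ∈ X

  -- X ∩ Σω, taken as a subset of Σω: the preimage of X under the
  -- inclusion of Σω in Σ∞.
  Pr : TraceSet → Pred Σω (a ⊔ lsuc ℓ)
  Pr X = inj₂ ⊢ X

  open Endo TraceSet using (_^_)

  ⟦_⟧ : LTL A → Answer → Pred Σω ℓ
  ⟦ ⊤ ⟧      T   = U
  ⟦ ⊤ ⟧      F   = ∅
  ⟦ atom p ⟧ T   = λ t → p ∈ t 0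
  ⟦ atom p ⟧ F   = λ t → p ∉ t 0
  ⟦ ¬ φ ⟧    T   = ⟦ φ ⟧ F
  ⟦ ¬ φ ⟧    F   = ⟦ φ ⟧ T
  ⟦ φ ∧ ψ ⟧  T   = ⟦ φ ⟧ T ∩ ⟦ ψ ⟧ T
  ⟦ φ ∧ ψ ⟧  F   = ⟦ φ ⟧ F ∪ ⟦ ψ ⟧ F
  ⟦ ◯ φ ⟧    b   = λ t → t ∣ω 1 ∈ ⟦ φ ⟧ b
  ⟦ φ 𝒰 ψ ⟧  T   = λ t →
    ∃[ k ] (∀ i → i < k → t ∣ω i ∈ ⟦ φ ⟧ T) × t ∣ω k ∈ ⟦ ψ ⟧ T
  ⟦ φ 𝒰 ψ ⟧  F   = λ t →
    ∀ k → (∃[ i ] i < k × t ∣ω i ∈ ⟦ φ ⟧ F) ⊎ t ∣ω k ∈ ⟦ ψ ⟧ F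

  ⟦_⟧₃ : LTL A → Answer → TraceSet
  ⟦ ⊤ ⟧₃      T = U
  ⟦ ⊤ ⟧₃      F = ∅
  ⟦ atom p ⟧₃ T = dp (λ t → ∃ λ (t≢ε : t ≢ ε) → p ∈ first t t≢ε)
  ⟦ atom p ⟧₃ F = dp (λ t → ∃ λ (t≢ε : t ≢ ε) → p ∉ first t t≢ε)
  ⟦ ¬ φ ⟧₃    T = ⟦ φ ⟧₃ F
  ⟦ ¬ φ ⟧₃    F = ⟦ φ ⟧₃ T
  ⟦ φ ∧ ψ ⟧₃  T = ⟦ φ ⟧₃ T ∩ ⟦ ψ ⟧₃ T
  ⟦ φ ∧ ψ ⟧₃  F = ⟦ φ ⟧₃ F ⊔ᵈ ⟦ ψ ⟧₃ F
  ⟦ ◯ φ ⟧₃    b = ▷ (⟦ φ ⟧₃ b)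
  ⟦ φ 𝒰 ψ ⟧₃  T = ⨆ ℕ λ k → (f ^ k) (⟦ ψ ⟧₃ T)
    where
    f : TraceSet → TraceSet
    f X = ▷ X ∩ ⟦ φ ⟧₃ T
  ⟦ φ 𝒰 ψ ⟧₃  F = ⋂ ℕ λ k → (g ^ k) (⟦ ψ ⟧₃ F)
    where
    g : TraceSet → TraceSet
    g X = ▷ X ⊔ᵈ ⟦ φ ⟧₃ F

{-# OPTIONS --safe #-}
-- An infinite trace has no proper extension, so on infinite traces dp only
-- closes a set under extensional equality of traces. The conventional
-- semantics is already closed under that equality, hence every dp disappears
-- under Pr; what remains of fᵏ and gᵏ is the k-step unrolling of 𝒰.
module Submission where

open import Defs
open import Level using (Level)
open import Data.Nat.Base using (ℕ; zero; suc; _<_; z<s; s<s; s<s⁻¹)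
open import Data.Product.Base as × using (_×_; _,_; proj₁; proj₂; ∃-syntax)
open import Data.Sum.Base as ⊎ using (_⊎_; inj₁; inj₂)
open import Data.Sum.Relation.Binary.Pointwise using (inj₂)
open import Function.Base using (id; _∘_)
open import Function.Endo.Propositional as Endo using ()
open import Relation.Binary.Core using (Rel)
open import Relation.Binary.Definitions using (_Respects_)
open import Relation.Unary using (Pred; _∈_; _≐_; _∩_; _∪_)
open import Relation.Unary.Properties using (≐-refl; ≐-sym; ≐-trans)

module _ {a} {A : Set a} {ℓ : Level} where

  open Semantics A ℓ
  open Endo TraceSet using (_^_)

  infix 4 _≈ω_
  _≈ω_ : Rel Σω _
  t ≈ω u = ∀ n → t n ≐ u n

  -- The two clauses of `𝒰` with `k` held fixed, so that each can be matched with a single iterate.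
  Until Release : ∀ {p} → Pred Σω p → Pred Σω p → ℕ → Pred Σω p
  Until   P Q k t = (∀ i → i < k → t ∣ω i ∈ P) × t ∣ω k ∈ Q
  Release P Q k t = (∃[ i ] i < k × t ∣ω i ∈ P) ⊎ t ∣ω k ∈ Q

  module _ {p} {P Q : Pred Σω p} (P-resp : P Respects _≈ω_) (Q-resp : Q Respects _≈ω_) where

    Until-resp : ∀ k → Until P Q k Respects _≈ω_
    Until-resp k t≈u = ×.map
      (λ Pt i i<k → P-resp (λ n → t≈u _) (Pt i i<k))
      (Q-resp (λ n → t≈u _))

    Release-resp : ∀ k → Release P Q k Respects _≈ω_
    Release-resp k t≈u = ⊎.map
      (λ (i , i<k , Pt) → i , i<k , P-resp (λ n → t≈u _) Pt)
      (Q-resp (λ n → t≈u _))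

  -- A formula inspects a trace only through membership of atoms in its states, and suffixes of
  -- equal traces are equal.
  ⟦⟧-resp : ∀ φ b → ⟦ φ ⟧ b Respects _≈ω_
  ⟦⟧-resp ⊤        T t≈u = id
  ⟦⟧-resp ⊤        F t≈u ()
  ⟦⟧-resp (atom p) T t≈u = proj₁ (t≈u 0)
  -- Non-membership is contravariant, hence the reverse inclusion of states.
  ⟦⟧-resp (atom p) F t≈u = _∘ proj₂ (t≈u 0)
  ⟦⟧-resp (¬ φ)    T = ⟦⟧-resp φ F
  ⟦⟧-resp (¬ φ)    F = ⟦⟧-resp φ T
  ⟦⟧-resp (φ ∧ ψ)  T t≈u = ×.map (⟦⟧-resp φ T t≈u) (⟦⟧-resp ψ T t≈u)
  ⟦⟧-resp (φ ∧ ψ)  F t≈u = ⊎.map (⟦⟧-resp φ F t≈u) (⟦⟧-resp ψ F t≈u)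
  ⟦⟧-resp (◯ φ)    b t≈u = ⟦⟧-resp φ b (t≈u ∘ suc)
  ⟦⟧-resp (φ 𝒰 ψ)  T t≈u (k , u) = k , Until-resp (⟦⟧-resp φ T) (⟦⟧-resp ψ T) k t≈u u
  ⟦⟧-resp (φ 𝒰 ψ)  F t≈u r k = Release-resp (⟦⟧-resp φ F) (⟦⟧-resp ψ F) k t≈u (r k)

  -- Appending to an infinite trace changes nothing, and only infinite members of `X` have an
  -- infinite prefix. The witness from `↓` is equal just up to `≈`, whence the closure condition on
  -- `P`.
  Pr-dp : ∀ {p} {P : Pred Σω p} → P Respects _≈ω_ → ∀ X → Pr X ≐ P → Pr (dp X) ≐ P
  Pr-dp {P = P} P-resp X (X⊆P , P⊆X) = to , from
    where
    to : ∀ {t} → inj₂ t ∈ dp X → t ∈ P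
    to t∈dp with t∈dp (ε , inj₂ (λ n → ≐-refl))
    ... | inj₂ t′ , t′∈X , _ , inj₂ t′≈t = P-resp t′≈t (X⊆P t′∈X)

    from : ∀ {t} → t ∈ P → inj₂ t ∈ dp X
    from Pt {inj₂ w} (_ , inj₂ w≈t) = inj₂ _ , P⊆X Pt , ε , inj₂ (≐-sym ∘ w≈t)

  module _ {p q} {P₁ P₂ : Pred Σω p} {Q₁ Q₂ : Pred Σω q} (P≐Q₁ : P₁ ≐ Q₁) (P≐Q₂ : P₂ ≐ Q₂) where

    ∩-cong : P₁ ∩ P₂ ≐ Q₁ ∩ Q₂
    ∩-cong = ×.map (proj₁ P≐Q₁) (proj₁ P≐Q₂) , ×.map (proj₂ P≐Q₁) (proj₂ P≐Q₂)

    ∪-cong : P₁ ∪ P₂ ≐ Q₁ ∪ Q₂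
    ∪-cong = ⊎.map (proj₁ P≐Q₁) (proj₁ P≐Q₂) , ⊎.map (proj₂ P≐Q₁) (proj₂ P≐Q₂)

  ◯-cong : ∀ {p q} {P : Pred Σω p} {Q : Pred Σω q} →
    P ≐ Q → (λ t → t ∣ω 1 ∈ P) ≐ (λ t → t ∣ω 1 ∈ Q)
  ◯-cong (P⊆Q , Q⊆P) = P⊆Q , Q⊆P

  module _ {p} {P Q : Pred Σω p} where

    -- One step of the expansion law: index 0 is split off and the others shift, as `(t ∣ω 1) ∣ω i`
    -- computes to `t ∣ω suc i`.
    Until-suc : ∀ k → (λ t → t ∣ω 1 ∈ Until P Q k) ∩ P ≐ Until P Q (suc k)
    Until-suc k =
        (λ ((Ps , Qt) , Pt) →
          (λ { zero _ → Pt ; (suc i) i<k → Ps i (s<s⁻¹ i<k) }) , Qt)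
      , (λ (Ps , Qt) → ((λ i i<k → Ps (suc i) (s<s i<k)) , Qt) , Ps 0 z<s)

    Release-suc : ∀ k → (λ t → t ∣ω 1 ∈ Release P Q k) ∪ P ≐ Release P Q (suc k)
    Release-suc k = to , from
      where
      to : ∀ {t} → t ∣ω 1 ∈ Release P Q k ⊎ t ∈ P → t ∈ Release P Q (suc k)
      to (inj₁ (inj₁ (i , i<k , Pt))) = inj₁ (suc i , s<s i<k , Pt)
      to (inj₁ (inj₂ Qt))             = inj₂ Qt
      to (inj₂ Pt)                    = inj₁ (0 , z<s , Pt)

      from : ∀ {t} → t ∈ Release P Q (suc k) → t ∣ω 1 ∈ Release P Q k ⊎ t ∈ P
      from (inj₁ (zero  , _   , Pt)) = inj₂ Pt
      from (inj₁ (suc i , i<k , Pt)) = inj₁ (inj₁ (i , s<s⁻¹ i<k , Pt))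
      from (inj₂ Qt)                 = inj₁ (inj₂ Qt)

    module _ {X Y : TraceSet} (X≐P : Pr X ≐ P) (Y≐Q : Pr Y ≐ Q) where

      -- `Pr` commutes with `▷` and `∩` by computation, and the outermost of the iterated steps
      -- accounts for index 0.
      Pr-Until : ∀ k → Pr (((λ Z → ▷ Z ∩ X) ^ k) Y) ≐ Until P Q k
      Pr-Until zero    = (λ Yt → (λ _ ()) , proj₁ Y≐Q Yt) , proj₂ Y≐Q ∘ proj₂
      Pr-Until (suc k) = ≐-trans (∩-cong (◯-cong (Pr-Until k)) X≐P) (Until-suc k)

      -- Every `⊔ᵈ` brings its own `dp`, so `Pr-dp` is applied at each successor step of the
      -- induction.
      Pr-Release : P Respects _≈ω_ → Q Respects _≈ω_ →
        ∀ k → Pr (((λ Z → ▷ Z ⊔ᵈ X) ^ k) Y) ≐ Release P Q k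
      Pr-Release P-resp Q-resp zero =
        inj₂ ∘ proj₁ Y≐Q , λ { (inj₁ (_ , () , _)) ; (inj₂ Qt) → proj₂ Y≐Q Qt }
      Pr-Release P-resp Q-resp (suc k) =
        Pr-dp (Release-resp P-resp Q-resp (suc k)) _
          (≐-trans (∪-cong (◯-cong (Pr-Release P-resp Q-resp k)) X≐P) (Release-suc k))

  -- Both answers go in one induction because `¬` exchanges them.
  Pr-⟦⟧₃ : ∀ φ b → Pr (⟦ φ ⟧₃ b) ≐ ⟦ φ ⟧ b
  Pr-⟦⟧₃ ⊤        T = _ , _
  Pr-⟦⟧₃ ⊤        F = (λ ()) , (λ ())
  -- `first` of an infinite trace computes to its state at 0, whatever the proof that the trace is
  -- not `ε`.
  Pr-⟦⟧₃ (atom p) T = Pr-dp (⟦⟧-resp (atom p) T) _ (proj₂ , (λ p∈ → (λ ()) , p∈))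
  Pr-⟦⟧₃ (atom p) F = Pr-dp (⟦⟧-resp (atom p) F) _ (proj₂ , (λ p∉ → (λ ()) , p∉))
  Pr-⟦⟧₃ (¬ φ)    T = Pr-⟦⟧₃ φ F
  Pr-⟦⟧₃ (¬ φ)    F = Pr-⟦⟧₃ φ T
  Pr-⟦⟧₃ (φ ∧ ψ)  T = ∩-cong (Pr-⟦⟧₃ φ T) (Pr-⟦⟧₃ ψ T)
  Pr-⟦⟧₃ (φ ∧ ψ)  F = Pr-dp (⟦⟧-resp (φ ∧ ψ) F) _ (∪-cong (Pr-⟦⟧₃ φ F) (Pr-⟦⟧₃ ψ F))
  Pr-⟦⟧₃ (◯ φ)    b = ◯-cong (Pr-⟦⟧₃ φ b)
  Pr-⟦⟧₃ (φ 𝒰 ψ)  T = Pr-dp (⟦⟧-resp (φ 𝒰 ψ) T) _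
    ((λ (k , t∈) → k , proj₁ (until k) t∈) , (λ (k , t∈) → k , proj₂ (until k) t∈))
    where until = Pr-Until (Pr-⟦⟧₃ φ T) (Pr-⟦⟧₃ ψ T)
  -- There is no outer `dp` here: `⋂` is compared separately at each `k`.
  Pr-⟦⟧₃ (φ 𝒰 ψ)  F =
    (λ t∈ k → proj₁ (release k) (t∈ k)) , (λ t∈ k → proj₂ (release k) (t∈ k))
    where release = Pr-Release (Pr-⟦⟧₃ φ F) (Pr-⟦⟧₃ ψ F) (⟦⟧-resp φ F) (⟦⟧-resp ψ F)

theorem7 : ∀ {a} (A : Set a) (ℓ : Level) (φ : LTL A) →
    let open Semantics A ℓ in
    (Pr (⟦ φ ⟧₃ T) ≐ ⟦ φ ⟧ T) × (Pr (⟦ φ ⟧₃ F) ≐ ⟦ φ ⟧ F)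
theorem7 A ℓ φ = Pr-⟦⟧₃ φ T , Pr-⟦⟧₃ φ F
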